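{- Let $R, S$ be two Dyck paths avoiding $NNN$, and let $P = \phi(R)$, $Q = \phi(S)$ be the corresponding Motzkin paths. Then $P \leq_{\mathcal{M}} Q$ if and only if $R \leq_D S$ and $\mathrm{Type}(R) = \mathrm{Type}(S)$ (that is, if and only if $[R,S]$ is a synchronized interval of Dyck paths avoiding $NNN$).
   Context: Paths: a Motzkin path is a non-empty lattice path in $\mathbb{Z}^2$ starting at $(0,0)$, ending on the diagonal $y=x$, staying weakly above the diagonal, with steps $N=(0,1)$, $E=(1,0)$, $D=(1,1)$. A Dyck path is a Motzkin path without $D$ steps. The size (length) of a path is its number of steps. Paths are viewed as words in $\{N,E,D\}$. $\mathcal{M}_n$ is the set of Motzkin paths of size $n$, $\mathcal{D}_{2n}$ the set of Dyck paths of size $2n$ ($n\ge 1$). Order: a valley of a path $P$ is a lattice point $v$ on $P$ preceded by an $E$ step and followed by an $N$ or $D$ step. Given a valley $v$ of a Motzkin path $P$, let $w$ be the next lattice point on $P$ after $v$ with the same horizontal distance to the diagonal as $v$ (the horizontal distance of $(a,b)$ is $b-a$). Exchanging the sub-path of $P$ between $v$ and $w$ with the $E$ step just before $v$ gives a Motzkin path $Q$; one says $Q$ covers $P$. The order $\leq_{\mathcal{M}}$ on $\mathcal{M}_n$ is the reflexive transitive closure of this covering relation. The same procedure applied to Dyck paths in $\mathcal{D}_{2n}$ gives the order $\leq_D$ (the Tamari lattice). Both orders only relate paths of the same size. Type: for $R\in\mathcal{D}_{2n}$, $\mathrm{Type}(R)$ is the word $w$ of length $n-1$ such that $w_i=N$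 if the $i$-th north step of $R$ is immediately followed by an east step, and $w_i=E$ otherwise. An interval $[R,S]$ (with $R\leq_D S$) is synchronized if $\mathrm{Type}(R)=\mathrm{Type}(S)$. The bijection $\phi$: a path avoids $NNN$ if it has no three consecutive $N$ steps. A Dyck path avoiding $NNN$ is uniquely written $R = N^{a_1}E^{b_1}\cdots N^{a_k}E^{b_k}$ with $a_i\in\{1,2\}$, $b_i\ge 1$. Set $\xi(1)=D$, $\xi(2)=N$, and $\phi(R)=\xi(a_1)E^{b_1-1}\cdots \xi(a_k)E^{b_k-1}$. This $\phi$ is a bijection from Dyck paths avoiding $NNN$ to Motzkin paths; $\phi^{ -1}$ replaces each $D$ by $NE$ and each $N$ by $NNE$. -}

module Defs where

open import Data.Empty using (⊥-elim)
open import Data.Integer using (ℤ; _⊖_)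
open import Data.Irrelevant using () renaming ([_] to irr)
open import Data.List using (List; []; _∷_; _++_; [_]; length; map; take; replicate; concatMap; inits)
open import Data.List.Membership.Propositional using (_∉_)
open import Data.List.Properties using (length-++)
open import Data.List.Relation.Binary.Infix.Heterogeneous using (Infix; here; there)
open import Data.List.Relation.Binary.Prefix.Heterogeneous using ([]; _∷_)
open import Data.List.Relation.Unary.All using (All; []; _∷_)
open import Data.List.Relation.Unary.All.Properties using (map⁺; map⁻)
import Data.List.Relation.Unary.All as All
import Data.List.Relation.Unary.Any as Any
open import Data.Nat using (ℕ; zero; suc; _+_; _∸_; _≤_; z≤n; s≤s)
open import Data.Nat.ListAction using (sum)
open import Data.Nat.Properties using (+-suc; +-identityʳ; suc-injective; ≤-trans; ≤-reflexive)
open import Data.Product using (_×_; _,_; proj₁; proj₂)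
open import Data.Refinement using (Refinement-syntax; _,_; value)
open import Function using (_on_; _∘_)
open import Relation.Binary.Construct.Closure.ReflexiveTransitive using (Star)
open import Relation.Binary.PropositionalEquality using (_≡_; _≢_; refl; sym; trans; cong; cong₂; subst)
open import Relation.Nullary using (¬_)

data Step : Set where
  N E D : Step

Word : Set
Word = List Step

δx δy : Step → ℕ
δx N = 0
δx E = 1
δx D = 1
δy N = 1
δy E = 0
δy D = 1

-- A word is read as a path from (0,0); the lattice points on the path are
-- the end points ⟨ x u , y u ⟩ of its prefixes u.
x y : Word → ℕ
x w = sum (map δx w)
y w = sum (map δy w)

-- Horizontal distance to the diagonal of the end point of w.
hdist : Word → ℤ
hdist w = y w ⊖ x w

record IsMotzkin (w : Word) : Set where
  constructor isMotzkin
  field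
    nonEmpty       : w ≢ []
    weaklyAbove    : All (λ u → x u ≤ y u) (inits w)
    endsOnDiagonal : x w ≡ y w

IsDyck : Word → Set
IsDyck w = IsMotzkin w × D ∉ w

-- In a refinement type the proof component is irrelevant, so two paths are
-- equal exactly when their words are.
MotzkinPath DyckPath : Set
MotzkinPath = [ w ∈ Word ∣ IsMotzkin w ]
DyckPath    = [ w ∈ Word ∣ IsDyck w ]

-- P ⋖ Q: the path Q covers P.  The valley v is the end point of
-- before ++ [ E ]; sub is the sub-path from v to the next point w at the same
-- horizontal distance, and Q is P with sub and the E before v exchanged.
record _⋖_ (P Q : Word) : Set where
  field
    before after : Word
    first        : Step
    rest         : Word
  sub : Word
  sub = first ∷ rest
  field
    P-split  : P ≡ before ++ [ E ] ++ sub ++ after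
    valley   : first ≢ E
    return   : hdist (before ++ [ E ] ++ sub) ≡ hdist (before ++ [ E ])
    earliest : ∀ u t → u ≢ [] → t ≢ [] → sub ≡ u ++ t →
               hdist (before ++ [ E ] ++ u) ≢ hdist (before ++ [ E ])
    Q-split  : Q ≡ before ++ sub ++ [ E ] ++ after

-- Covering preserves the size (see ⋖-length), so the closures below, taken on
-- paths of all sizes at once, restrict on each size to the order on paths of
-- that size and relate no paths of different sizes.
infix 4 _≤M_ _≤D_

_≤M_ : MotzkinPath → MotzkinPath → Set
_≤M_ = Star (_⋖_ on value)

_≤D_ : DyckPath → DyckPath → Set
_≤D_ = Star (_⋖_ on value)

⋖-length : ∀ {P Q} → P ⋖ Q → length P ≡ length Q
⋖-length c = trans (cong length P-split)
  (trans (length-++ before)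
  (trans (cong (length before +_) eq)
  (trans (sym (length-++ before)) (cong length (sym Q-split)))))
  where
  open _⋖_ c
  eq : suc (length (sub ++ after)) ≡ length (sub ++ E ∷ after)
  eq = trans (cong suc (length-++ sub))
      (trans (sym (+-suc (length sub) (length after))) (sym (length-++ sub)))

-- The letter of a north step, given the steps that follow it.
northLetter : Word → Step
northLetter (E ∷ _) = N
northLetter _       = E

northLetters : Word → Word
northLetters []      = []
northLetters (N ∷ w) = northLetter w ∷ northLetters w
northLetters (E ∷ w) = northLetters w
northLetters (D ∷ w) = northLetters w

-- A Dyck path R of size 2n has y (value R) = n north steps; the last one
-- contributes no letter.
Type : DyckPath → Word
Type R = take (y (value R) ∸ 1) (northLetters (value R))

AvoidsNNN : Word → Set
AvoidsNNN w = ¬ Infix _≡_ (N ∷ N ∷ N ∷ []) w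

data Exponent : Set where
  one two : Exponent

toℕ : Exponent → ℕ
toℕ one = 1
toℕ two = 2

-- The pair (a , c) stands for the factor Nᵃ Eᵇ with b = 1 + c.
Block : Set
Block = Exponent × ℕ

unblock : Block → Word
unblock (a , c) = replicate (toℕ a) N ++ replicate (suc c) E

ξ : Exponent → Step
ξ one = D
ξ two = N

ξ-block : Block → Word
ξ-block (a , c) = ξ a ∷ replicate c E

leadingE : Word → ℕ
leadingE (E ∷ w) = suc (leadingE w)
leadingE _       = 0

-- The unique factorisation into blocks of a Dyck path avoiding NNN (see
-- unblock-blocks and blocks-unblock); values on other words are arbitrary.
blocks : Word → List Block
blocks (E ∷ w)         = blocks w
blocks (N ∷ E ∷ w)     = (one , leadingE w) ∷ blocks w
blocks (N ∷ N ∷ E ∷ w) = (two , leadingE w) ∷ blocks w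
blocks _               = []

φ-word : Word → Word
φ-word w = concatMap ξ-block (blocks w)

-- Every list of blocks is recovered from its word.
blocks-unblock : ∀ bs → blocks (concatMap unblock bs) ≡ bs
blocks-unblock = go
  where
  leading : ∀ bs → leadingE (concatMap unblock bs) ≡ 0
  leading []              = refl
  leading ((one , _) ∷ _) = refl
  leading ((two , _) ∷ _) = refl

  leading-E : ∀ c bs → leadingE (replicate c E ++ concatMap unblock bs) ≡ c
  leading-E zero    bs = leading bs
  leading-E (suc c) bs = cong suc (leading-E c bs)

  skip : ∀ c w → blocks (replicate c E ++ w) ≡ blocks w
  skip zero    w = refl
  skip (suc c) w = skip c w

  go : ∀ bs → blocks (concatMap unblock bs) ≡ bs
  go []               = refl
  go ((one , c) ∷ bs) = cong₂ (λ k → (one , k) ∷_) (leading-E c bs) (trans (skip c _) (go bs))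
  go ((two , c) ∷ bs) = cong₂ (λ k → (two , k) ∷_) (leading-E c bs) (trans (skip c _) (go bs))

-- From height h, the path w stays weakly above the diagonal and ends on it.
data Descends : ℕ → Word → Set where
  []   : Descends 0 []
  N∷_  : ∀ {h w} → Descends (suc h) w → Descends h (N ∷ w)
  E∷_  : ∀ {h w} → Descends h w → Descends (suc h) (E ∷ w)
  D∷_  : ∀ {h w} → Descends h w → Descends h (D ∷ w)

descends : ∀ h w → All (λ u → x u ≤ h + y u) (inits w) → x w ≡ h + y w → Descends h w
descends h [] _ e with refl ← trans e (+-identityʳ h) = []
descends h (N ∷ w) (_ ∷ a) e =
  N∷ descends (suc h) w (All.map (λ p → ≤-trans p (≤-reflexive (+-suc h _))) (map⁻ a))
                        (trans e (+-suc h _))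
descends zero (E ∷ []) (_ ∷ () ∷ _) _
descends zero (E ∷ _ ∷ _) (_ ∷ () ∷ _) _
descends (suc h) (E ∷ w) (_ ∷ a) e =
  E∷ descends h w (All.map (λ { (s≤s p) → p }) (map⁻ a)) (suc-injective e)
descends h (D ∷ w) (_ ∷ a) e =
  D∷ descends h w (All.map (λ p → drop (≤-trans p (≤-reflexive (+-suc h _)))) (map⁻ a))
                  (suc-injective (trans e (+-suc h _)))
  where
  drop : ∀ {m n} → suc m ≤ suc n → m ≤ n
  drop (s≤s p) = p

descends⁻¹ : ∀ {h w} → Descends h w →
             All (λ u → x u ≤ h + y u) (inits w) × x w ≡ h + y w
descends⁻¹ [] = (z≤n ∷ []) , refl
descends⁻¹ {h} (N∷ d) with descends⁻¹ d
... | a , e = (z≤n ∷ map⁺ (All.map (λ p → ≤-trans p (≤-reflexive (sym (+-suc h _)))) a))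
            , trans e (sym (+-suc h _))
descends⁻¹ (E∷ d) with descends⁻¹ d
... | a , e = (z≤n ∷ map⁺ (All.map s≤s a)) , cong suc e
descends⁻¹ {h} (D∷ d) with descends⁻¹ d
... | a , e = (z≤n ∷ map⁺ (All.map (λ p → ≤-trans (s≤s p) (≤-reflexive (sym (+-suc h _)))) a))
            , trans (cong suc e) (sym (+-suc h _))

-- A Dyck path avoiding NNN is the product of its blocks.
unblock-blocks : ∀ {w} → IsDyck w → AvoidsNNN w → concatMap unblock (blocks w) ≡ w
unblock-blocks {w} (m , noD) av =
  trans (cong (λ k → replicate k E ++ concatMap unblock (blocks w)) (sym (start d)))
        (sym (go w d noD av))
  where
  d : Descends 0 w
  d = descends 0 w (IsMotzkin.weaklyAbove m) (IsMotzkin.endsOnDiagonal m)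

  start : ∀ {w} → Descends 0 w → leadingE w ≡ 0
  start []     = refl
  start (N∷ _) = refl
  start (D∷ _) = refl

  go : ∀ {h} w → Descends h w → D ∉ w → AvoidsNNN w →
       w ≡ replicate (leadingE w) E ++ concatMap unblock (blocks w)
  go [] _ _ _ = refl
  go (E ∷ w) (E∷ d) nd av = cong (E ∷_) (go w d (nd ∘ Any.there) (av ∘ there))
  go (D ∷ w) _ nd _ = ⊥-elim (nd (Any.here refl))
  go (N ∷ []) (N∷ ()) _ _
  go (N ∷ D ∷ w) _ nd _ = ⊥-elim (nd (Any.there (Any.here refl)))
  go (N ∷ E ∷ w) (N∷ E∷ d) nd av =
    cong (λ v → N ∷ E ∷ v)
      (go w d (nd ∘ Any.there ∘ Any.there) (av ∘ there ∘ there))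
  go (N ∷ N ∷ []) (N∷ N∷ ()) _ _
  go (N ∷ N ∷ N ∷ w) _ _ av = ⊥-elim (av (here (refl ∷ refl ∷ refl ∷ [])))
  go (N ∷ N ∷ D ∷ w) _ nd _ = ⊥-elim (nd (Any.there (Any.there (Any.here refl))))
  go (N ∷ N ∷ E ∷ w) (N∷ N∷ E∷ d) nd av =
    cong (λ v → N ∷ N ∷ E ∷ v)
      (go w d (nd ∘ Any.there ∘ Any.there ∘ Any.there) (av ∘ there ∘ there ∘ there))

φ-motzkin : ∀ {w} → IsDyck w → AvoidsNNN w → IsMotzkin (φ-word w)
φ-motzkin {w} dy@(m , _) av = isMotzkin (ne (blocks w) eq) (proj₁ r) (proj₂ r)
  where
  eq : concatMap unblock (blocks w) ≡ w
  eq = unblock-blocks dy av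

  ne : ∀ bs → concatMap unblock bs ≡ w → concatMap ξ-block bs ≢ []
  ne []      e _ = IsMotzkin.nonEmpty m (sym e)
  ne (_ ∷ _) _ ()

  run : ∀ {h} c bs → Descends h (replicate c E ++ concatMap unblock bs) →
        Descends h (replicate c E ++ concatMap ξ-block bs)
  run (suc c) bs               (E∷ d)        = E∷ run c bs d
  run zero    []               []            = []
  run zero    ((one , c) ∷ bs) (N∷ E∷ d)     = D∷ run c bs d
  run zero    ((two , c) ∷ bs) (N∷ N∷ E∷ d)  = N∷ run c bs d

  r = descends⁻¹ (run 0 (blocks w)
        (subst (Descends 0) (sym eq)
          (descends 0 w (IsMotzkin.weaklyAbove m) (IsMotzkin.endsOnDiagonal m))))

φ : (R : DyckPath) → AvoidsNNN (value R) → MotzkinPath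
φ (w , irr d) av = φ-word w , irr (φ-motzkin d av)

{-# OPTIONS --safe #-}

-- φ⁻¹ is the substitution ψ : N ↦ NNE, D ↦ NE, E ↦ E, which preserves heights
-- at the boundaries of letters and therefore turns Motzkin covers into Dyck
-- covers; the word of north letters of ψ w is obtained from w letter by letter,
-- with E contributing nothing, so these covers preserve it.  Conversely, the
-- number of peaks (factors NE) never increases along a cover, and it drops when
-- the E before the valley is preceded by an N.  If R and S have the same type
-- then no cover on a chain from R to S drops it.  So the E before each valley is
-- preceded by an E or starts the word, which means that it is itself the image
-- of a letter E under ψ, and the cover is the image of a Motzkin cover.

module Submission where

open import Algebra.Properties.AbelianGroup using (identityʳ-unique)
open import Algebra.Properties.CommutativeSemigroup using (interchange)
open import Data.Integer as ℤ using (+_; -_; _⊖_)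
import Data.Integer.Properties as ℤ
open import Data.Irrelevant using () renaming ([_] to irr)
open import Data.List using ([]; _∷_; _++_; _∷ʳ_; [_]; map; take; replicate; concatMap)
open import Data.List.Membership.Propositional using (_∉_)
open import Data.List.Properties using (≡-dec; ++-assoc; map-++; concatMap-++; ∷-injectiveʳ; ∷ʳ-injectiveˡ)
open import Data.List.Relation.Unary.Any using (here; there)
open import Data.Nat using (ℕ; zero; suc; _+_; _∸_; _≤_; _<_; z≤n; s≤s)
open import Data.Nat.ListAction using (sum)
open import Data.Nat.ListAction.Properties using (sum-++)
open import Data.Nat.Properties
  using (+-suc; suc-injective; ≤-refl; ≤-reflexive; ≤-trans; <⇒≢; <⇒≱; +-mono-≤; +-mono-≤-<)
open import Data.Product using (_×_; _,_; proj₁; proj₂; ∃; ∃₂)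
open import Data.Refinement using (value; _,_; value-injective)
open import Data.Sum using (_⊎_; inj₁; inj₂)
open import Defs
open import Function using (_∘_)
open import Function.Bundles using (_⇔_; mk⇔)
open import Relation.Binary.Construct.Closure.ReflexiveTransitive using (ε; _◅_; gmap)
open import Relation.Binary.Definitions using (DecidableEquality)
open import Relation.Binary.PropositionalEquality
  using (_≡_; _≢_; refl; sym; trans; cong; cong₂; subst; subst₂; module ≡-Reasoning)
open import Relation.Nullary using (yes; no; recompute; contradiction)

_≟_ : DecidableEquality Step
N ≟ N = yes refl
N ≟ E = no λ ()
N ≟ D = no λ ()
E ≟ N = no λ ()
E ≟ E = yes refl
E ≟ D = no λ ()
D ≟ N = no λ ()
D ≟ E = no λ ()
D ≟ D = yes refl

-- Horizontal distance along concatenations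

x-++ : ∀ u v → x (u ++ v) ≡ x u + x v
x-++ u v = trans (cong sum (map-++ δx u v)) (sum-++ (map δx u) (map δx v))

y-++ : ∀ u v → y (u ++ v) ≡ y u + y v
y-++ u v = trans (cong sum (map-++ δy u v)) (sum-++ (map δy u) (map δy v))

hdist-++ : ∀ u v → hdist (u ++ v) ≡ hdist u ℤ.+ hdist v
hdist-++ u v = begin
  y (u ++ v) ⊖ x (u ++ v)                               ≡⟨ cong₂ _⊖_ (y-++ u v) (x-++ u v) ⟩
  (y u + y v) ⊖ (x u + x v)                             ≡⟨ ℤ.m-n≡m⊖n (y u + y v) (x u + x v) ⟨
  + (y u + y v) ℤ.- + (x u + x v)                       ≡⟨ cong (λ k → + (y u + y v) ℤ.+ k) (ℤ.neg-distrib-+ (+ x u) (+ x v)) ⟩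
  (+ y u ℤ.+ + y v) ℤ.+ (- + x u ℤ.+ - + x v)           ≡⟨ interchange ℤ.+-commutativeSemigroup (+ y u) (+ y v) (- + x u) (- + x v) ⟩
  (+ y u ℤ.- + x u) ℤ.+ (+ y v ℤ.- + x v)               ≡⟨ cong₂ ℤ._+_ (ℤ.m-n≡m⊖n (y u) (x u)) (ℤ.m-n≡m⊖n (y v) (x v)) ⟩
  hdist u ℤ.+ hdist v                                   ∎
  where open ≡-Reasoning

-- Horizontal distance is additive, so the prefix up to the valley cancels and the return condition
-- concerns the sub-path alone.
hdist-cancel : ∀ b u → hdist (b ++ [ E ] ++ u) ≡ hdist (b ++ [ E ]) → y u ≡ x u
hdist-cancel b u e = ℤ.+-injective (ℤ.i-j≡0⇒i≡j (+ y u) (+ x u)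
  (trans (ℤ.m-n≡m⊖n (y u) (x u))
    (identityʳ-unique ℤ.+-0-abelianGroup (hdist (b ++ [ E ])) (hdist u)
      (trans (sym (hdist-++ (b ++ [ E ]) u))
        (trans (cong hdist (++-assoc b [ E ] u)) e)))))

hdist-extend : ∀ b u → y u ≡ x u → hdist (b ++ [ E ] ++ u) ≡ hdist (b ++ [ E ])
hdist-extend b u e = begin
  hdist (b ++ [ E ] ++ u)           ≡⟨ cong hdist (++-assoc b [ E ] u) ⟨
  hdist ((b ++ [ E ]) ++ u)         ≡⟨ hdist-++ (b ++ [ E ]) u ⟩
  hdist (b ++ [ E ]) ℤ.+ hdist u    ≡⟨ cong (λ k → hdist (b ++ [ E ]) ℤ.+ (k ⊖ x u)) e ⟩
  hdist (b ++ [ E ]) ℤ.+ (x u ⊖ x u) ≡⟨ cong (λ k → hdist (b ++ [ E ]) ℤ.+ k) (ℤ.n⊖n≡0 (x u)) ⟩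
  hdist (b ++ [ E ]) ℤ.+ ℤ.0ℤ       ≡⟨ ℤ.+-identityʳ _ ⟩
  hdist (b ++ [ E ])                ∎
  where open ≡-Reasoning

-- Covers described by excursions

-- From height h, the path w reaches height 0 at its end and not before.
data FirstReturn : ℕ → Word → Set where
  []  : FirstReturn 0 []
  N∷_ : ∀ {h w} → FirstReturn (2 + h) w → FirstReturn (1 + h) (N ∷ w)
  E∷_ : ∀ {h w} → FirstReturn h w → FirstReturn (1 + h) (E ∷ w)
  D∷_ : ∀ {h w} → FirstReturn (1 + h) w → FirstReturn (1 + h) (D ∷ w)

-- The possible sub-paths between a valley and the next point at its height.
data Excursion : Word → Set where
  [D] : Excursion (D ∷ [])
  N∷_ : ∀ {w} → FirstReturn 1 w → Excursion (N ∷ w)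

-- The last hypothesis only forbids height 0 at proper prefixes. This suffices: only E descends, and
-- by one, so the height cannot become negative without visiting 0.
firstReturn : ∀ h w → suc h + y w ≡ x w →
              (∀ u t → t ≢ [] → w ≡ u ++ t → suc h + y u ≢ x u) →
              FirstReturn (suc h) w
firstReturn h [] () _
firstReturn h (N ∷ w) e early =
  N∷ firstReturn (suc h) w (trans (sym (+-suc (suc h) (y w))) e)
       (λ u t t≢[] eq → early (N ∷ u) t t≢[] (cong (N ∷_) eq) ∘ trans (+-suc (suc h) (y u)))
firstReturn zero (E ∷ []) _ _ = E∷ []
-- This E already reaches height 0, with a non-empty rest after it.
firstReturn zero (E ∷ c ∷ w) _ early = contradiction refl (early [ E ] (c ∷ w) (λ ()) refl)
firstReturn (suc h) (E ∷ w) e early =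
  E∷ firstReturn h w (suc-injective e)
       (λ u t t≢[] eq → early (E ∷ u) t t≢[] (cong (E ∷_) eq) ∘ cong suc)
firstReturn h (D ∷ w) e early =
  D∷ firstReturn h w (suc-injective (trans (sym (+-suc (suc h) (y w))) e))
       (λ u t t≢[] eq → early (D ∷ u) t t≢[] (cong (D ∷_) eq) ∘ trans (+-suc (suc h) (y u)) ∘ cong suc)

returns : ∀ {h w} → FirstReturn h w → h + y w ≡ x w
returns []             = refl
returns {h} (N∷_ {w = w} r) = trans (+-suc h (y w)) (returns r)
returns (E∷ r)         = cong suc (returns r)
returns {h} (D∷_ {w = w} r) = trans (+-suc h (y w)) (cong suc (returns r))

staysAbove : ∀ {h w} → FirstReturn h w → ∀ u t → t ≢ [] → w ≡ u ++ t → x u < h + y u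
staysAbove []     []      t t≢[] eq   = contradiction (sym eq) t≢[]
staysAbove (N∷ _) []      t _    _    = s≤s z≤n
staysAbove (E∷ _) []      t _    _    = s≤s z≤n
staysAbove (D∷ _) []      t _    _    = s≤s z≤n
staysAbove {h} (N∷ r) (N ∷ u) t t≢[] refl =
  ≤-trans (staysAbove r u t t≢[] refl) (≤-reflexive (sym (+-suc h (y u))))
staysAbove (E∷ r) (E ∷ u) t t≢[] refl = s≤s (staysAbove r u t t≢[] refl)
staysAbove {h} (D∷ r) (D ∷ u) t t≢[] refl =
  ≤-trans (s≤s (staysAbove r u t t≢[] refl)) (≤-reflexive (sym (+-suc h (y u))))

⋖-excursion : ∀ {P Q} (c : P ⋖ Q) → Excursion (_⋖_.sub c)
⋖-excursion c = go first rest valley (hdist-cancel before sub return)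
  (λ u t u≢[] t≢[] eq → earliest u t u≢[] t≢[] eq ∘ hdist-extend before u)
  where
  open _⋖_ c
  go : ∀ c w → c ≢ E → y (c ∷ w) ≡ x (c ∷ w) →
       (∀ u t → u ≢ [] → t ≢ [] → c ∷ w ≡ u ++ t → y u ≢ x u) → Excursion (c ∷ w)
  go N w _ e early =
    N∷ firstReturn 0 w e (λ u t t≢[] eq → early (N ∷ u) t (λ ()) t≢[] (cong (N ∷_) eq))
  go E w c≢E _ _ = contradiction refl c≢E
  go D [] _ _ _ = [D]
  -- A first step D is back at the distance of the valley at once, so a longer sub-path would
  -- violate `earliest`.
  go D (c ∷ w) _ _ early = contradiction refl (early [ D ] (c ∷ w) (λ ()) (λ ()) refl)

excursion-⋖ : ∀ b {s} a → Excursion s → (b ++ E ∷ s ++ a) ⋖ (b ++ s ++ E ∷ a)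
excursion-⋖ b a [D] = record
  { before = b ; after = a ; first = D ; rest = []
  ; P-split = refl ; valley = λ () ; return = hdist-extend b [ D ] refl
  ; earliest = λ { []      _  u≢[] _    _ → contradiction refl u≢[]
                 ; (_ ∷ []) [] _    t≢[] _ → contradiction refl t≢[] }
  ; Q-split = refl }
excursion-⋖ b a (N∷_ {w} r) = record
  { before = b ; after = a ; first = N ; rest = w
  ; P-split = refl ; valley = λ () ; return = hdist-extend b (N ∷ w) (returns r)
  ; earliest = λ { []      t u≢[] _    _    → contradiction refl u≢[]
                 ; (N ∷ u) t _    t≢[] refl →
                     <⇒≢ (staysAbove r u t t≢[] refl) ∘ sym ∘ hdist-cancel b (N ∷ u) }
  ; Q-split = refl }

-- Peaks

-- In a word of north letters only N contributes to y.
peaks : Word → ℕ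
peaks w = y (northLetters w)

northLetter-insertE : ∀ {h w} a → FirstReturn (suc h) w →
                      northLetter (w ++ E ∷ a) ≡ northLetter (w ++ a)
northLetter-insertE a (N∷ _) = refl
northLetter-insertE a (E∷ _) = refl
northLetter-insertE a (D∷ _) = refl

-- Before the end of `w` the height is positive, so the part of `w` after each N is non-empty: the
-- step following N lies in `w`, and the inserted E cannot replace it.
northLetters-insertE : ∀ {h w} a → FirstReturn h w →
                       northLetters (w ++ E ∷ a) ≡ northLetters (w ++ a)
northLetters-insertE a []     = refl
northLetters-insertE a (N∷ r) = cong₂ _∷_ (northLetter-insertE a r) (northLetters-insertE a r)
northLetters-insertE a (E∷ r) = northLetters-insertE a r
northLetters-insertE a (D∷ r) = northLetters-insertE a r

peaks-excursion : ∀ {s} a → Excursion s → peaks (s ++ E ∷ a) ≡ peaks (s ++ a)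
peaks-excursion a [D]    = refl
peaks-excursion a (N∷ r) =
  cong y (cong₂ _∷_ (northLetter-insertE a r) (northLetters-insertE a r))

northLetter-excursion : ∀ {s} a → Excursion s → northLetter (s ++ a) ≡ E
northLetter-excursion a [D]    = refl
northLetter-excursion a (N∷ _) = refl

northLetter-head : ∀ c {u v} → northLetter (c ∷ u) ≡ northLetter (c ∷ v)
northLetter-head N = refl
northLetter-head E = refl
northLetter-head D = refl

-- In the application `u` is the suffix after a cover and `v` the one before it. Only a north step
-- at the end of `b` has a letter depending on the suffix, and in front of `u` that letter counts 0.
peaks-mono : ∀ b {u v} → northLetter u ≡ E → peaks u ≤ peaks v → peaks (b ++ u) ≤ peaks (b ++ v)
peaks-mono []          e le = le
peaks-mono (N ∷ [])    e le = +-mono-≤ (≤-trans (≤-reflexive (cong δy e)) z≤n) le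
peaks-mono (N ∷ c ∷ b) e le =
  +-mono-≤ (≤-reflexive (cong δy (northLetter-head c))) (peaks-mono (c ∷ b) e le)
peaks-mono (E ∷ b)     e le = peaks-mono b e le
peaks-mono (D ∷ b)     e le = peaks-mono b e le

-- The N after `b` forms a peak with the E in front of `v`, but none with the first step of `u`.
peaks-strict : ∀ b {u v} → northLetter u ≡ E → peaks u ≤ peaks v →
               peaks (b ∷ʳ N ++ u) < peaks (b ∷ʳ N ++ E ∷ v)
peaks-strict []          e le = s≤s (+-mono-≤ (≤-reflexive (cong δy e)) le)
peaks-strict (N ∷ [])    {u} {v} e le = peaks-strict [] {u} {v} e le
peaks-strict (N ∷ c ∷ b) e le =
  +-mono-≤-< (≤-reflexive (cong δy (northLetter-head c))) (peaks-strict (c ∷ b) e le)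
peaks-strict (E ∷ b)     e le = peaks-strict b e le
peaks-strict (D ∷ b)     e le = peaks-strict b e le

peaks-⋖ : ∀ {P Q} → P ⋖ Q → peaks Q ≤ peaks P
peaks-⋖ c = subst₂ _≤_ (cong peaks (sym Q-split)) (cong peaks (sym P-split))
  (peaks-mono before (northLetter-excursion (E ∷ after) exc)
    (≤-reflexive (peaks-excursion after exc)))
  where
  open _⋖_ c
  exc = ⋖-excursion c

peaks-≤D : ∀ {R S} → R ≤D S → peaks (value S) ≤ peaks (value R)
peaks-≤D ε       = ≤-refl
peaks-≤D (c ◅ s) = ≤-trans (peaks-≤D s) (peaks-⋖ c)

-- The type and the word of all north letters

northLetters-∷ʳ : ∀ {h w} → Descends h (N ∷ w) → D ∉ N ∷ w →
                  northLetters (N ∷ w) ≡ take (y w) (northLetters (N ∷ w)) ∷ʳ N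
-- The N in front is the letter of the north step just read; it is the last letter exactly when no
-- north step remains in `w`.
afterPeak : ∀ {h w} → Descends h w → D ∉ w →
            N ∷ northLetters w ≡ take (y w) (N ∷ northLetters w) ∷ʳ N

northLetters-∷ʳ (N∷ d@(N∷ _)) nd = cong (E ∷_) (northLetters-∷ʳ d (nd ∘ there))
northLetters-∷ʳ (N∷ E∷ d)     nd = afterPeak d (nd ∘ there ∘ there)
northLetters-∷ʳ (N∷ D∷ d)     nd = contradiction (there (here refl)) nd

afterPeak []         nd = refl
afterPeak d@(N∷ _)   nd = cong (N ∷_) (northLetters-∷ʳ d nd)
afterPeak (E∷ d)     nd = afterPeak d (nd ∘ there)
afterPeak (D∷ d)     nd = contradiction (here refl) nd

-- Without D, the last north step can only be followed by E, so the letter omitted by `Type` is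
-- always N. Hence equal types amount to equal words of north letters.
northLetters-Type : ∀ R → northLetters (value R) ≡ Type R ∷ʳ N
-- The Dyck proof is irrelevant; decidable equality of words permits its use here.
northLetters-Type (w , irr dyck) = recompute (≡-dec _≟_ _ _) (go w dyck)
  where
  go : ∀ w → IsDyck w → northLetters w ≡ take (y w ∸ 1) (northLetters w) ∷ʳ N
  go w (m , nd) with descends 0 w (IsMotzkin.weaklyAbove m) (IsMotzkin.endsOnDiagonal m)
  ... | []         = contradiction refl (IsMotzkin.nonEmpty m)
  ... | d@(N∷ _)   = northLetters-∷ʳ d nd
  ... | D∷ _       = contradiction (here refl) nd

-- The inverse of φ

ψ-letter : Step → Word
ψ-letter N = N ∷ N ∷ E ∷ []
ψ-letter E = E ∷ []
ψ-letter D = N ∷ E ∷ []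

ψ : Word → Word
ψ = concatMap ψ-letter

ψ-++ : ∀ u v → ψ (u ++ v) ≡ ψ u ++ ψ v
ψ-++ = concatMap-++ ψ-letter

-- A left inverse of ψ; values outside the image of ψ are arbitrary.
ψ⁻ : Word → Word
ψ⁻ (N ∷ N ∷ E ∷ w) = N ∷ ψ⁻ w
ψ⁻ (N ∷ E ∷ w)     = D ∷ ψ⁻ w
ψ⁻ (E ∷ w)         = E ∷ ψ⁻ w
ψ⁻ _               = []

ψ⁻-ψ : ∀ w → ψ⁻ (ψ w) ≡ w
ψ⁻-ψ []      = refl
ψ⁻-ψ (N ∷ w) = cong (N ∷_) (ψ⁻-ψ w)
ψ⁻-ψ (E ∷ w) = cong (E ∷_) (ψ⁻-ψ w)
ψ⁻-ψ (D ∷ w) = cong (D ∷_) (ψ⁻-ψ w)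

ψ-injective : ∀ {u v} → ψ u ≡ ψ v → u ≡ v
ψ-injective {u} {v} e = trans (sym (ψ⁻-ψ u)) (trans (cong ψ⁻ e) (ψ⁻-ψ v))

-- The leading run is there for the induction: it holds the east steps left over from an opened
-- block.
ψ-easts-blocks : ∀ c bs → ψ (replicate c E ++ concatMap ξ-block bs) ≡
                          replicate c E ++ concatMap unblock bs
ψ-easts-blocks (suc c) bs               = cong (E ∷_) (ψ-easts-blocks c bs)
ψ-easts-blocks zero    []               = refl
ψ-easts-blocks zero    ((one , c) ∷ bs) = cong (λ w → N ∷ E ∷ w) (ψ-easts-blocks c bs)
ψ-easts-blocks zero    ((two , c) ∷ bs) = cong (λ w → N ∷ N ∷ E ∷ w) (ψ-easts-blocks c bs)

ψ-φ : ∀ R r → value R ≡ ψ (value (φ R r))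
ψ-φ (w , irr dyck) r = recompute (≡-dec _≟_ _ _)
  (trans (sym (unblock-blocks dyck r)) (sym (ψ-easts-blocks 0 (blocks w))))

ψ-descends : ∀ {h w} → Descends h w → Descends h (ψ w)
ψ-descends []     = []
ψ-descends (N∷ d) = N∷ N∷ E∷ ψ-descends d
ψ-descends (E∷ d) = E∷ ψ-descends d
ψ-descends (D∷ d) = N∷ E∷ ψ-descends d

ψ-descends⁻ : ∀ {h} w → Descends h (ψ w) → Descends h w
ψ-descends⁻ []      []            = []
ψ-descends⁻ (N ∷ w) (N∷ N∷ E∷ d)  = N∷ ψ-descends⁻ w d
ψ-descends⁻ (E ∷ w) (E∷ d)        = E∷ ψ-descends⁻ w d
ψ-descends⁻ (D ∷ w) (N∷ E∷ d)     = D∷ ψ-descends⁻ w d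

D∉ψ : ∀ w → D ∉ ψ w
D∉ψ (N ∷ w) (there (there (there p))) = D∉ψ w p
D∉ψ (E ∷ w) (there p)                 = D∉ψ w p
D∉ψ (D ∷ w) (there (there p))         = D∉ψ w p

motzkin⇒descends : ∀ {w} → IsMotzkin w → Descends 0 w
motzkin⇒descends m = descends 0 _ (IsMotzkin.weaklyAbove m) (IsMotzkin.endsOnDiagonal m)

descends⇒motzkin : ∀ {w} → w ≢ [] → Descends 0 w → IsMotzkin w
descends⇒motzkin w≢[] d = isMotzkin w≢[] (proj₁ (descends⁻¹ d)) (proj₂ (descends⁻¹ d))

ψ-dyck : ∀ {w} → IsMotzkin w → IsDyck (ψ w)
ψ-dyck {w} m =
  descends⇒motzkin (IsMotzkin.nonEmpty m ∘ ψ-injective {w} {[]}) (ψ-descends (motzkin⇒descends m)) , D∉ψ w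

ψ-dyck⁻ : ∀ {w} → IsDyck (ψ w) → IsMotzkin w
ψ-dyck⁻ {w} (m , _) =
  descends⇒motzkin (IsMotzkin.nonEmpty m ∘ cong ψ) (ψ-descends⁻ w (motzkin⇒descends m))

-- Inside the image of a letter the path is strictly higher than at its start, so no earlier visit
-- to height 0 arises.
ψ-firstReturn : ∀ {h w} → FirstReturn h w → FirstReturn h (ψ w)
ψ-firstReturn []     = []
ψ-firstReturn (N∷ r) = N∷ N∷ E∷ ψ-firstReturn r
ψ-firstReturn (E∷ r) = E∷ ψ-firstReturn r
ψ-firstReturn (D∷ r) = N∷ E∷ ψ-firstReturn r

ψ-excursion : ∀ {s} → Excursion s → Excursion (ψ s)
ψ-excursion [D]    = N∷ E∷ []
ψ-excursion (N∷ r) = N∷ N∷ E∷ ψ-firstReturn r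

ψ-⋖ : ∀ {P Q} → P ⋖ Q → ψ P ⋖ ψ Q
ψ-⋖ c = subst₂ _⋖_
  (trans (cong (λ w → ψ before ++ E ∷ w) (sym (ψ-++ sub after)))
    (trans (sym (ψ-++ before (E ∷ sub ++ after))) (cong ψ (sym P-split))))
  (trans (cong (ψ before ++_) (sym (ψ-++ sub (E ∷ after))))
    (trans (sym (ψ-++ before (sub ++ E ∷ after))) (cong ψ (sym Q-split))))
  (excursion-⋖ (ψ before) (ψ after) (ψ-excursion (⋖-excursion c)))
  where open _⋖_ c

letters : Step → Word
letters N = E ∷ N ∷ []
letters E = []
letters D = N ∷ []

-- Each north step of `ψ w` has its successor within the image of the same letter, so its own letter
-- does not depend on the context.
northLetters-ψ : ∀ w → northLetters (ψ w) ≡ concatMap letters w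
northLetters-ψ []      = refl
northLetters-ψ (N ∷ w) = cong (λ v → E ∷ N ∷ v) (northLetters-ψ w)
northLetters-ψ (E ∷ w) = northLetters-ψ w
northLetters-ψ (D ∷ w) = cong (N ∷_) (northLetters-ψ w)

northLetters-ψ-⋖ : ∀ {P Q} → P ⋖ Q → northLetters (ψ P) ≡ northLetters (ψ Q)
northLetters-ψ-⋖ {P} {Q} c = begin
  northLetters (ψ P)                         ≡⟨ northLetters-ψ P ⟩
  L P                                        ≡⟨ cong L P-split ⟩
  L (before ++ E ∷ sub ++ after)             ≡⟨ L-++ before (E ∷ sub ++ after) ⟩
  L before ++ L (sub ++ after)               ≡⟨ cong (L before ++_) (L-++ sub after) ⟩
  L before ++ L sub ++ L after               ≡⟨ cong (L before ++_) (L-++ sub (E ∷ after)) ⟨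
  L before ++ L (sub ++ E ∷ after)           ≡⟨ L-++ before (sub ++ E ∷ after) ⟨
  L (before ++ sub ++ E ∷ after)             ≡⟨ cong L Q-split ⟨
  L Q                                        ≡⟨ northLetters-ψ Q ⟨
  northLetters (ψ Q)                         ∎
  where
  open _⋖_ c
  open ≡-Reasoning
  L = concatMap letters
  L-++ = concatMap-++ letters

ψ-path : MotzkinPath → DyckPath
ψ-path (w , irr m) = ψ w , irr (ψ-dyck m)

ψ-path-φ : ∀ R r → ψ-path (φ R r) ≡ R
ψ-path-φ R r = value-injective (sym (ψ-φ R r))

ψ-≤ : ∀ {P Q} → P ≤M Q → ψ-path P ≤D ψ-path Q
ψ-≤ = gmap ψ-path ψ-⋖

northLetters-≤M : ∀ {P Q} → P ≤M Q → northLetters (ψ (value P)) ≡ northLetters (ψ (value Q))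
northLetters-≤M ε       = refl
northLetters-≤M (c ◅ s) = trans (northLetters-ψ-⋖ c) (northLetters-≤M s)

-- Lifting Dyck covers along ψ

-- An E in `ψ p` is either the image of a letter E or the end of `NNE` or `NE`, where an N precedes
-- it.
ψ-splitE : ∀ p b {v} → ψ p ≡ b ++ E ∷ v →
           (∃₂ λ b′ v′ → p ≡ b′ ++ E ∷ v′ × ψ b′ ≡ b × ψ v′ ≡ v) ⊎ (∃ λ b₀ → b ≡ b₀ ∷ʳ N)
ψ-splitE (E ∷ p) []      eq = inj₁ ([] , p , refl , refl , ∷-injectiveʳ eq)
ψ-splitE (E ∷ p) (E ∷ b) eq with ψ-splitE p b (∷-injectiveʳ eq)
... | inj₁ (b′ , v′ , refl , refl , e) = inj₁ (E ∷ b′ , v′ , refl , refl , e)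
... | inj₂ (b₀ , refl)                 = inj₂ (E ∷ b₀ , refl)
ψ-splitE (N ∷ p) (N ∷ N ∷ [])    eq = inj₂ ([ N ] , refl)
ψ-splitE (N ∷ p) (N ∷ N ∷ E ∷ b) eq
  with ψ-splitE p b (∷-injectiveʳ (∷-injectiveʳ (∷-injectiveʳ eq)))
... | inj₁ (b′ , v′ , refl , refl , e) = inj₁ (N ∷ b′ , v′ , refl , refl , e)
... | inj₂ (b₀ , refl)                 = inj₂ (N ∷ N ∷ E ∷ b₀ , refl)
ψ-splitE (D ∷ p) (N ∷ [])        eq = inj₂ ([] , refl)
ψ-splitE (D ∷ p) (N ∷ E ∷ b)     eq with ψ-splitE p b (∷-injectiveʳ (∷-injectiveʳ eq))
... | inj₁ (b′ , v′ , refl , refl , e) = inj₁ (D ∷ b′ , v′ , refl , refl , e)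
... | inj₂ (b₀ , refl)                 = inj₂ (N ∷ E ∷ b₀ , refl)

-- The images of N and D never end below their starting height, so a first descent to 0 is made by
-- the image of a letter E and stops at a letter boundary.
ψ-splitReturn : ∀ {h s} p {a} → FirstReturn h s → ψ p ≡ s ++ a →
                ∃₂ λ s′ a′ → p ≡ s′ ++ a′ × ψ s′ ≡ s × ψ a′ ≡ a × FirstReturn h s′
ψ-splitReturn p       []     eq = [] , p , refl , refl , eq , []
ψ-splitReturn []      (D∷ _) ()
ψ-splitReturn (N ∷ _) (D∷ _) ()
ψ-splitReturn (E ∷ _) (D∷ _) ()
ψ-splitReturn (D ∷ _) (D∷ _) ()
ψ-splitReturn (E ∷ p) (E∷ r) eq with ψ-splitReturn p r (∷-injectiveʳ eq)
... | s′ , a′ , refl , refl , e , r′ = E ∷ s′ , a′ , refl , refl , e , E∷ r′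
ψ-splitReturn (N ∷ p) (N∷ N∷ E∷ r) eq
  with ψ-splitReturn p r (∷-injectiveʳ (∷-injectiveʳ (∷-injectiveʳ eq)))
... | s′ , a′ , refl , refl , e , r′ = N ∷ s′ , a′ , refl , refl , e , N∷ r′
ψ-splitReturn (D ∷ p) (N∷ E∷ r) eq with ψ-splitReturn p r (∷-injectiveʳ (∷-injectiveʳ eq))
... | s′ , a′ , refl , refl , e , r′ = D ∷ s′ , a′ , refl , refl , e , D∷ r′

ψ-splitExcursion : ∀ {s} p {a} → Excursion s → ψ p ≡ s ++ a →
                   ∃₂ λ s′ a′ → p ≡ s′ ++ a′ × ψ s′ ≡ s × ψ a′ ≡ a × Excursion s′
ψ-splitExcursion []      [D] ()
ψ-splitExcursion (N ∷ _) [D] ()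
ψ-splitExcursion (E ∷ _) [D] ()
ψ-splitExcursion (D ∷ _) [D] ()
ψ-splitExcursion (N ∷ p) (N∷ N∷ E∷ r) eq
  with ψ-splitReturn p r (∷-injectiveʳ (∷-injectiveʳ (∷-injectiveʳ eq)))
... | s′ , a′ , refl , refl , e , r′ = N ∷ s′ , a′ , refl , refl , e , N∷ r′
-- `NE` returns at once, so the excursion is the image of a single D.
ψ-splitExcursion (D ∷ p) (N∷ E∷ []) eq =
  [ D ] , p , refl , refl , ∷-injectiveʳ (∷-injectiveʳ eq) , [D]

⋖-lift : ∀ p {R T} → R ≡ ψ p → R ⋖ T → peaks R ≤ peaks T → ∃ λ t → T ≡ ψ t × p ⋖ t
⋖-lift p {R} {T} eR c le with ψ-splitE p (_⋖_.before c) (trans (sym eR) (_⋖_.P-split c))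
-- The E before the valley ends a peak; the cover destroys it, against `le`.
... | inj₂ (b₀ , eb) = contradiction le (<⇒≱ (subst₂ _<_
    (cong peaks (trans (cong (_++ sub ++ E ∷ after) (sym eb)) (sym Q-split)))
    (cong peaks (trans (cong (_++ E ∷ sub ++ after) (sym eb)) (sym P-split)))
    (peaks-strict b₀ (northLetter-excursion (E ∷ after) exc)
      (≤-reflexive (peaks-excursion after exc)))))
  where
  open _⋖_ c
  exc = ⋖-excursion c
... | inj₁ (b , v , refl , eb , ev) with ψ-splitExcursion v (⋖-excursion c) ev
...   | s , a , refl , es , ea , exc = b ++ s ++ E ∷ a , T≡ψ , excursion-⋖ b a exc
  where
  open _⋖_ c
  T≡ψ : T ≡ ψ (b ++ s ++ E ∷ a)
  T≡ψ = begin
    T                              ≡⟨ Q-split ⟩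
    before ++ sub ++ E ∷ after     ≡⟨ cong₂ _++_ (sym eb) (cong₂ _++_ (sym es) (cong (E ∷_) (sym ea))) ⟩
    ψ b ++ ψ s ++ ψ (E ∷ a)        ≡⟨ cong (ψ b ++_) (ψ-++ s (E ∷ a)) ⟨
    ψ b ++ ψ (s ++ E ∷ a)          ≡⟨ ψ-++ b (s ++ E ∷ a) ⟨
    ψ (b ++ s ++ E ∷ a)            ∎
    where open ≡-Reasoning

-- Peaks never increase along the chain, so the inequality between its ends makes their number
-- constant, and `⋖-lift` applies to every cover.
≤D-lift : ∀ {R S} → R ≤D S → ∀ P Q → value R ≡ ψ (value P) → value S ≡ ψ (value Q) →
          peaks (value R) ≤ peaks (value S) → P ≤M Q
≤D-lift ε P Q eR eS _ with refl ← value-injective {v = P} {w = Q} (ψ-injective (trans (sym eR) eS)) = ε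
≤D-lift (_◅_ {j = T} c s) P Q eR eS le
  with t , eT , c′ ← ⋖-lift (value P) eR c (≤-trans le (peaks-≤D s)) =
  c′ ◅ ≤D-lift s (mid T t eT) Q eT eS (≤-trans (peaks-⋖ c) le)
  where
  -- The intermediate preimage is a Motzkin path because its image under `ψ` is the Dyck path `T`.
  mid : ∀ T t → value T ≡ ψ t → MotzkinPath
  mid (_ , irr d) t e = t , irr (ψ-dyck⁻ (subst IsDyck e d))

theorem3p3 : (R S : DyckPath) (r : AvoidsNNN (value R)) (s : AvoidsNNN (value S)) →
    (φ R r ≤M φ S s) ⇔ ((R ≤D S) × (Type R ≡ Type S))
theorem3p3 R S r s = mk⇔ to from
  where
  to : φ R r ≤M φ S s → (R ≤D S) × (Type R ≡ Type S)
  to le = subst₂ _≤D_ (ψ-path-φ R r) (ψ-path-φ S s) (ψ-≤ le) ,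
    ∷ʳ-injectiveˡ (Type R) (Type S) (begin
      Type R ∷ʳ N                           ≡⟨ northLetters-Type R ⟨
      northLetters (value R)                ≡⟨ cong northLetters (ψ-φ R r) ⟩
      northLetters (ψ (value (φ R r)))      ≡⟨ northLetters-≤M le ⟩
      northLetters (ψ (value (φ S s)))      ≡⟨ cong northLetters (ψ-φ S s) ⟨
      northLetters (value S)                ≡⟨ northLetters-Type S ⟩
      Type S ∷ʳ N                           ∎)
    where open ≡-Reasoning

  from : (R ≤D S) × (Type R ≡ Type S) → φ R r ≤M φ S s
  from (le , eq) = ≤D-lift le (φ R r) (φ S s) (ψ-φ R r) (ψ-φ S s)
    -- Of the equality of types, only the resulting equality of peak numbers is needed.
    (≤-reflexive (cong y (trans (northLetters-Type R)
      (trans (cong (_∷ʳ N) eq) (sym (northLetters-Type S))))))
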